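{- Let $p$ be a prime and let $G$ be a $\mathbb{Z}_p$-module with partial decomposition bases $\mathcal{C}$ and $\mathcal{C}'$. Suppose that for some equivalence class $e$ of Ulm sequences and some natural number $n$, $\hat{w}_{\mathcal{C}}(e,G) \ge n$. Then for any $Y \in \mathcal{C}'$ there is $\tilde{Y} \in \mathcal{C}'$ such that $Y \subseteq \tilde{Y}$ and $\tilde{Y}$ contains at least $n$ elements $y$ with $U(y) \in e$.
   Context: $\mathbb{Z}_p$ denotes the integers localized at the prime $p$. Define $p^0G=G$, $p^{\beta+1}G=p(p^\beta G)$, $p^\alpha G=\bigcap_{\beta<\alpha}p^\beta G$ for limit $\alpha$; the height $|x|$ of $x \in G$ is the ordinal $\alpha$ with $x\in p^\alpha G\setminus p^{\alpha+1}G$, or the symbol $\infty$ if none exists. The Ulm sequence of $x$ is $U(x)=(|p^ix|)_{i\in\omega}$. Two Ulm sequences $(\alpha_i)$, $(\beta_i)$ are equivalent if there are positive integers $m,n$ with $\alpha_{i+n}=\beta_{i+m}$ for all $i\ge0$. A subset $X\subseteq G$ is a decomposition set if it is a linearly independent set of elements of infinite order and $|a_1x_1+\cdots+a_nx_n|=\min_i|a_ix_i|$ for all $x_i\in X$, $a_i\in\mathbb{Z}_p$. For a submodule $K$, $K^0=\{x\in G: ax\in K\text{ for some }a\ne0\}$. A partial decomposition basis for $G$ is a nonempty collection $\mathcal{C}$ of finite decomposition sets of $G$ such that for all $X\in\mathcal{C}$ and $x\in G$ there is $Y\in\mathcal{C}$ with $X\subseteq Y$ and $x\in\langle Y\rangle^0$.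 For such $\mathcal{C}$ and an equivalence class $e$ of Ulm sequences, $\hat{w}_{\mathcal{C}}(e,G)$ is the maximum $n$ such that there are $X\in\mathcal{C}$ and distinct $x_1,\dots,x_n\in X$ with $U(x_i)\in e$ for all $i$, if such a maximum exists, and $\omega$ otherwise. -}

module Defs where

open import Level using (Level; _⊔_; 0ℓ) renaming (suc to lsuc)
open import Data.Nat as ℕ using (ℕ; zero; suc; _<_; _+_)
open import Data.Nat.Divisibility using (_∣_; ∣1⇒≡1)
open import Data.Nat.Primality using (Prime; euclidsLemma; ¬prime[1])
open import Data.Integer as ℤ using (ℤ; +_)
open import Data.Rational.Unnormalised.Base as Q using (ℚᵘ; mkℚᵘ; ↧ₙ_)
import Data.Rational.Unnormalised.Properties as QP
open import Data.Product using (Σ; _×_; _,_; proj₁; proj₂)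
open import Data.Sum using (inj₁; inj₂)
open import Data.Fin using (Fin; zero; suc)
open import Relation.Nullary using (¬_)
open import Relation.Binary.Core using (Rel)
open import Relation.Binary.PropositionalEquality using (_≡_; refl; subst)
open import Relation.Unary using (Pred)
open import Induction.WellFounded using (Acc; acc)
open import Algebra.Bundles using (RawRing; CommutativeRing)
open import Algebra.Morphism.Structures using (IsRingMonomorphism)
import Algebra.Morphism.RingMonomorphism as RingMono
open import Algebra.Module.Bundles using (Module)

-- The ring ℤ_p: the integers localised at the prime p, realised as the
-- subring { a/b : p ∤ b } of the (unnormalised) rationals.

module Localisation (p : ℕ) (pr : Prime p) where

  Carrierₚ : Set
  Carrierₚ = Σ ℚᵘ (λ q → ¬ (p ∣ ↧ₙ q))

  _≈ₚ_ : Rel Carrierₚ 0ℓ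
  x ≈ₚ y = proj₁ x Q.≃ proj₁ y

  private
    closed : ∀ b d → ¬ (p ∣ suc b) → ¬ (p ∣ suc d) → ¬ (p ∣ suc b ℕ.* suc d)
    closed b d h k q with euclidsLemma (suc b) (suc d) pr q
    ... | inj₁ x = h x
    ... | inj₂ y = k y

    p∤1 : ¬ (p ∣ 1)
    p∤1 q = ¬prime[1] (subst Prime (∣1⇒≡1 q) pr)

  _+ₚ_ : Carrierₚ → Carrierₚ → Carrierₚ
  (mkℚᵘ a b , h) +ₚ (mkℚᵘ c d , k) = (mkℚᵘ a b Q.+ mkℚᵘ c d , closed b d h k)

  _*ₚ_ : Carrierₚ → Carrierₚ → Carrierₚ
  (mkℚᵘ a b , h) *ₚ (mkℚᵘ c d , k) = (mkℚᵘ a b Q.* mkℚᵘ c d , closed b d h k)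

  -ₚ_ : Carrierₚ → Carrierₚ
  -ₚ (mkℚᵘ a b , h) = (Q.- mkℚᵘ a b , h)

  0ₚ 1ₚ : Carrierₚ
  0ₚ = (mkℚᵘ (+ 0) 0 , p∤1)
  1ₚ = (mkℚᵘ (+ 1) 0 , p∤1)

  fromℕₚ : ℕ → Carrierₚ
  fromℕₚ k = (mkℚᵘ (+ k) 0 , p∤1)

  rawRing : RawRing 0ℓ 0ℓ
  rawRing = record
    { Carrier = Carrierₚ ; _≈_ = _≈ₚ_ ; _+_ = _+ₚ_ ; _*_ = _*ₚ_
    ; -_ = -ₚ_ ; 0# = 0ₚ ; 1# = 1ₚ }

  private
    +h : ∀ x y → proj₁ (x +ₚ y) Q.≃ (proj₁ x Q.+ proj₁ y)
    +h (mkℚᵘ a b , h) (mkℚᵘ c d , k) = QP.≃-refl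
    *h : ∀ x y → proj₁ (x *ₚ y) Q.≃ (proj₁ x Q.* proj₁ y)
    *h (mkℚᵘ a b , h) (mkℚᵘ c d , k) = QP.≃-refl
    -h : ∀ x → proj₁ (-ₚ x) Q.≃ (Q.- proj₁ x)
    -h (mkℚᵘ a b , h) = QP.≃-refl

  isMono : IsRingMonomorphism rawRing QP.+-*-rawRing proj₁
  isMono = record
    { isRingHomomorphism = record
      { isSemiringHomomorphism = record
        { isNearSemiringHomomorphism = record
          { +-isMonoidHomomorphism = record
            { isMagmaHomomorphism = record
              { isRelHomomorphism = record { cong = λ z → z }
              ; homo = +h }
            ; ε-homo = QP.≃-refl }
          ; *-homo = *h }
        ; 1#-homo = QP.≃-refl }
      ; -‿homo = -h }
    ; injective = λ z → z }

  ring : CommutativeRing 0ℓ 0ℓ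
  ring = record
    { isCommutativeRing =
        RingMono.isCommutativeRing isMono QP.+-*-isCommutativeRing }

ℤ[_] : (p : ℕ) → Prime p → CommutativeRing 0ℓ 0ℓ
ℤ[ p ] pr = Localisation.ring p pr

module Theory {m ℓm : Level} {p : ℕ} {pr : Prime p}
              (G : Module (ℤ[ p ] pr) m ℓm) where

  open Module G
  open CommutativeRing (ℤ[ p ] pr) using () renaming (Carrier to R; _≈_ to _≈R_; 0# to 0R)

  p·_ : Carrierᴹ → Carrierᴹ
  p· x = Localisation.fromℕₚ p pr p *ₗ x

  pow : ℕ → Carrierᴹ → Carrierᴹ
  pow zero x = x
  pow (suc i) x = p· (pow i x)

  _·ℕ_ : ℕ → Carrierᴹ → Carrierᴹ
  zero ·ℕ x = 0ᴹ
  suc k ·ℕ x = x +ᴹ (k ·ℕ x)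

  -- Ordinals are represented by elements of well-founded relations
  -- (an element w of rank α represents α).  The submodule p^α G is
  --   p^α G = ⋂_{β<α} p (p^β G)
  -- which agrees with the paper's recursion (p^0 G = G, successor,
  -- intersection at limits).  InP a x  means  x ∈ p^{rank w} G.
  InP : {W : Set m} {_<_ : Rel W m} {w : W} → Acc _<_ w → Carrierᴹ → Set (m ⊔ ℓm)
  InP {_<_ = _<_} {w} (acc rs) x =
    ∀ {v} (v<w : v < w) → Σ Carrierᴹ (λ y → InP (rs v<w) y × (x ≈ᴹ p· y))

  -- |x| = |y|  (heights equal, including the value ∞): x and y lie in
  -- exactly the same members of the chain p^α G.
  SameHeight : Carrierᴹ → Carrierᴹ → Set (lsuc m ⊔ ℓm)
  SameHeight x y = ∀ (W : Set m) (_<_ : Rel W m) (w : W) (a : Acc _<_ w) →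
                   (InP a x → InP a y) × (InP a y → InP a x)

  -- |y| = min_i |z_i|   (min of the empty family is ∞)
  IsMinHeight : Carrierᴹ → {k : ℕ} → (Fin k → Carrierᴹ) → Set (lsuc m ⊔ ℓm)
  IsMinHeight y z = ∀ (W : Set m) (_<_ : Rel W m) (w : W) (a : Acc _<_ w) →
                    (InP a y → ∀ i → InP a (z i)) × ((∀ i → InP a (z i)) → InP a y)

  UlmEquiv : Carrierᴹ → Carrierᴹ → Set (lsuc m ⊔ ℓm)
  UlmEquiv x y = Σ ℕ λ m' → Σ ℕ λ n → 0 < m' × 0 < n ×
                 (∀ i → SameHeight (pow (i + n) x) (pow (i + m') y))

  record FinSet : Set m where
    field
      size : ℕ
      elt  : Fin size → Carrierᴹ
  open FinSet public

  LinComb : {k : ℕ} → (Fin k → R) → (Fin k → Carrierᴹ) → Carrierᴹ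
  LinComb {zero}  a x = 0ᴹ
  LinComb {suc k} a x = (a zero *ₗ x zero) +ᴹ LinComb (λ i → a (suc i)) (λ i → x (suc i))

  LinIndep : FinSet → Set ℓm
  LinIndep X = ∀ (a : Fin (size X) → R) → LinComb a (elt X) ≈ᴹ 0ᴹ → ∀ i → a i ≈R 0R

  InfiniteOrder : Carrierᴹ → Set ℓm
  InfiniteOrder x = ∀ (k : ℕ) → ¬ (suc k ·ℕ x ≈ᴹ 0ᴹ)

  IsDecompositionSet : FinSet → Set (lsuc m ⊔ ℓm)
  IsDecompositionSet X =
    LinIndep X × (∀ i → InfiniteOrder (elt X i)) ×
    (∀ (a : Fin (size X) → R) → IsMinHeight (LinComb a (elt X)) (λ i → a i *ₗ elt X i))

  _⊆ₛ_ : FinSet → FinSet → Set ℓm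
  X ⊆ₛ Y = ∀ i → Σ (Fin (size Y)) λ j → elt X i ≈ᴹ elt Y j

  InSpan⁰ : Carrierᴹ → FinSet → Set ℓm
  InSpan⁰ x Y = Σ R λ a → ¬ (a ≈R 0R) ×
                Σ (Fin (size Y) → R) λ c → a *ₗ x ≈ᴹ LinComb c (elt Y)

  IsPartialDecompositionBasis : ∀ {c} → Pred FinSet c → Set (lsuc m ⊔ ℓm ⊔ c)
  IsPartialDecompositionBasis C =
    Σ FinSet C ×
    (∀ X → C X → IsDecompositionSet X) ×
    (∀ X → C X → ∀ x → Σ FinSet λ Y → C Y × X ⊆ₛ Y × InSpan⁰ x Y)

  -- X contains at least n distinct elements whose Ulm sequence lies in the
  -- equivalence class e = [U(g)]
  ContainsAtLeast : FinSet → ℕ → Carrierᴹ → Set (lsuc m ⊔ ℓm)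
  ContainsAtLeast X n g =
    Σ (Fin n → Fin (size X)) λ f →
      (∀ i j → elt X (f i) ≈ᴹ elt X (f j) → i ≡ j) ×
      (∀ i → UlmEquiv (elt X (f i)) g)

  -- ŵ_C(e,G) ≥ n, with e = [U(g)]: unfolding the definition of ŵ as a
  -- maximum (or ω), this says some X ∈ C has n distinct elements in e.
  ŵ≥ : ∀ {c} → Pred FinSet c → Carrierᴹ → ℕ → Set (lsuc m ⊔ ℓm ⊔ c)
  ŵ≥ C g n = Σ FinSet λ X → C X × ContainsAtLeast X n g

{-# OPTIONS --safe #-}

-- Enlarge Y to Y₁ ∈ C′ whose purification contains the given elements x₁, …, xₙ of X, and
-- X to X₁ ∈ C whose purification contains Y₁; clear denominators, so that
-- a xᵢ ∈ ⟨Y₁⟩ and b y ∈ ⟨X₁⟩ for y ∈ Y₁.  Replacing xᵢ by suitable multiples xᵢ′ = p^νᵢ xᵢ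
-- makes their Ulm sequences equal.  If fewer than n elements of Y₁ were in the class e,
-- linear algebra would give a nontrivial z = Σ wᵢ xᵢ′ such that a z = Σ dⱼ yⱼ only
-- involves yⱼ outside e.  Let wₒ divide all wᵢ, so that |r z| = |r wₒ xₒ′| for all r, and
-- compare the coefficients of xₒ in b a z: with b yⱼ = Σ uⱼₗ xₗ this reads
-- q = Σⱼ dⱼ uⱼₒ, where q = b a wₒ p^νₒ.  Each term is divisible by p q, for otherwise
-- |r dⱼ uⱼₒ xₒ| ≥ |r b dⱼ yⱼ| ≥ |r b a z| = |r q xₒ| ≥ |r dⱼ uⱼₒ xₒ| for all r,
-- which puts yⱼ in e.  Hence p q divides q ≠ 0, a contradiction.

module Submission where

open import Defs
open import Level using (Level; _⊔_) renaming (suc to lsuc)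
open import Algebra.Bundles using (CommutativeMonoid; CommutativeRing)
open import Algebra.Module.Bundles using (Module)
import Algebra.Properties.CommutativeMonoid.Sum as MonoidSum
import Algebra.Properties.CommutativeSemigroup.Divisibility as CommutativeSemigroupDivisibility
import Algebra.Properties.Ring as RingProperties
import Algebra.Properties.Semiring.Divisibility as SemiringDivisibility
import Algebra.Properties.Semiring.Exp as SemiringExp
import Algebra.Properties.Semiring.Sum as SemiringSum
open import Axiom.ExcludedMiddle using (ExcludedMiddle)
open import Data.Bool using (if_then_else_)
open import Data.Empty using (⊥; ⊥-elim)
open import Data.Fin as Fin using (Fin; zero; suc; punchIn)
open import Data.Fin.Properties using (any?; punchInᵢ≢i)
open import Data.Integer as ℤ using (+_; +[1+_]; -[1+_]; +0)
import Data.Integer.Divisibility.Signed as ℤS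
import Data.Integer.Properties as ℤP
open import Data.Nat as ℕ using (ℕ; z≤n; s≤s)
import Data.Nat.Divisibility as ℕD
open import Data.Nat.Induction using (<-wellFounded)
open import Data.Nat.Primality using (Prime; ¬prime[0]; prime⇒nonTrivial)
import Data.Nat.Properties as ℕP
open import Data.Product using (Σ; _×_; ∃; _,_; proj₁; proj₂; swap)
open import Data.Rational.Unnormalised as Q using (mkℚᵘ; *≡*)
import Data.Rational.Unnormalised.Properties as QP
open import Data.Sum as Sum using (_⊎_; inj₁; inj₂)
open import Data.Vec.Functional using (insertAt)
open import Data.Vec.Functional.Properties using (insertAt-lookup; insertAt-punchIn)
open import Function using (_∘_)
open import Induction.WellFounded using (Acc; acc)
open import Relation.Binary.Bundles using (Setoid)
open import Relation.Binary.Core using (Rel)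
open import Relation.Binary.PropositionalEquality as ≡ using (_≡_; _≢_)
import Relation.Binary.Reasoning.Setoid as SetoidReasoning
open import Relation.Nullary using (¬_; Dec; yes; no; does)
open import Relation.Nullary.Decidable using (¬?; decidable-stable; _×-dec_)
open import Relation.Unary using (Pred; Decidable)

-- Enumerating a decidable subset of a finite index set

injection-or-cover : ∀ {ℓ m} {J : Pred (Fin m) ℓ} → Decidable J → ∀ n →
  (Σ (Fin n → Fin m) λ f → (∀ i j → f i ≡ f j → i ≡ j) × (∀ i → J (f i)))
  ⊎ (∃ λ k → Σ (Fin k → Fin m) λ h → k ℕ.< n × (∀ j → J j → ∃ λ t → h t ≡ j))
injection-or-cover J? ℕ.zero = inj₁ ((λ ()) , (λ ()) , λ ())
injection-or-cover J? (ℕ.suc n) with injection-or-cover J? n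
... | inj₂ (k , h , k<n , cover) = inj₂ (k , h , ℕP.m<n⇒m<1+n k<n , cover)
... | inj₁ (f , f-inj , f∈J) with any? (λ j → J? j ×-dec ¬? (any? (λ i → f i Fin.≟ j)))
-- Here `f` already meets all of `J`, so it serves as the cover. Its length is strictly below the
-- requested one, which later leaves fewer equations than unknowns.
...   | no none = inj₂ (n , f , ℕP.≤-refl , λ j j∈J →
          decidable-stable (any? (λ i → f i Fin.≟ j)) (λ j∉f → none (j , j∈J , j∉f)))
...   | yes (j , j∈J , j∉f) = inj₁ (f′ , f′-inj , f′∈J)
  where
  f′ : Fin (ℕ.suc n) → Fin _
  f′ zero = j
  f′ (suc i) = f i
  f′-inj : ∀ a b → f′ a ≡ f′ b → a ≡ b
  f′-inj zero zero _ = ≡.refl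
  f′-inj zero (suc b) e = ⊥-elim (j∉f (b , ≡.sym e))
  f′-inj (suc a) zero e = ⊥-elim (j∉f (a , e))
  f′-inj (suc a) (suc b) e = ≡.cong suc (f-inj a b e)
  f′∈J : ∀ a → _
  f′∈J zero = j∈J
  f′∈J (suc a) = f∈J a

bounded : ∀ {n} (f : Fin n → ℕ) → ∃ λ b → ∀ i → f i ℕ.≤ b
bounded {ℕ.zero} f = 0 , λ ()
bounded {ℕ.suc n} f with bounded (f ∘ suc)
... | b , f≤b = f zero ℕ.⊔ b , λ
  { zero → ℕP.m≤m⊔n (f zero) b
  ; (suc i) → ℕP.≤-trans (f≤b i) (ℕP.m≤n⊔m (f zero) b) }

-- Sums and divisibility in a discrete valuation ring

module SparseSums {c ℓ} (M : CommutativeMonoid c ℓ) where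
  open CommutativeMonoid M
  open MonoidSum M

  ∑-zero : ∀ {n} {t : Fin n → Carrier} → (∀ i → t i ≈ ε) → sum t ≈ ε
  ∑-zero {n} t≈0 = trans (sum-cong-≋ t≈0) (sum-replicate-zero n)

  ∑-single : ∀ {n} (t : Fin n → Carrier) k → (∀ i → i ≢ k → t i ≈ ε) → sum t ≈ t k
  ∑-single {ℕ.suc n} t k t≈0 =
    trans (sum-remove {i = k} t)
      (trans (∙-congˡ (∑-zero (λ j → t≈0 (punchIn k j) (punchInᵢ≢i k j)))) (identityʳ _))

-- In `factor`, `_∥_` is mutual divisibility: a nonzero element is a unit times a power of `π`, and
-- the exponent is its valuation. Zero has no finite valuation and is kept apart by `≟0`.
record IsDiscreteValuationRing {c ℓ} (R : CommutativeRing c ℓ) (π : CommutativeRing.Carrier R)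
  : Set (c ⊔ ℓ) where
  open CommutativeRing R
  open SemiringDivisibility semiring using (_∣_; _∥_)
  open SemiringExp semiring using (_^_)
  field
    ≟0 : ∀ x → Dec (x ≈ 0#)
    integral : ∀ x y → x * y ≈ 0# → x ≈ 0# ⊎ y ≈ 0#
    π≉0 : ¬ (π ≈ 0#)
    π∤1 : ¬ (π ∣ 1#)
    factor : ∀ x → ¬ (x ≈ 0#) → ∃ λ t → x ∥ (π ^ t)

module DiscreteValuation {c ℓ} {R : CommutativeRing c ℓ} {π : CommutativeRing.Carrier R}
  (dvr : IsDiscreteValuationRing R π) where
  open CommutativeRing R hiding (zero)
  open IsDiscreteValuationRing dvr
  open SemiringDivisibility semiring
  open CommutativeSemigroupDivisibility *-commutativeSemigroup using (x∣y⇒zx∣zy)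
  open SemiringExp semiring
  open SemiringSum semiring
  open RingProperties ring
  open SparseSums +-commutativeMonoid
  open SetoidReasoning setoid

  1≉0 : ¬ (1# ≈ 0#)
  1≉0 1≈0 = π∤1 (0# , trans (zeroˡ π) (sym 1≈0))

  *≉0 : ∀ {x y} → ¬ (x ≈ 0#) → ¬ (y ≈ 0#) → ¬ (x * y ≈ 0#)
  *≉0 x≉0 y≉0 xy≈0 with integral _ _ xy≈0
  ... | inj₁ x≈0 = x≉0 x≈0
  ... | inj₂ y≈0 = y≉0 y≈0

  ^-∣ : ∀ {s t} → s ℕ.≤ t → π ^ s ∣ π ^ t
  ^-∣ {s} {t} s≤t = π ^ (t ℕ.∸ s) ,
    trans (sym (^-homo-* π (t ℕ.∸ s) s)) (^-congʳ π (ℕP.m∸n+n≡m s≤t))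

  ∣-∑ : ∀ {n x} {t : Fin n → Carrier} → (∀ i → x ∣ t i) → x ∣ sum t
  ∣-∑ {x = x} x∣t = sum quotients ,
    trans (*-distribʳ-sum x quotients) (sum-cong-≋ (λ i → _∣ʳ_.equality (x∣t i)))
    where quotients = λ i → _∣ʳ_.quotient (x∣t i)

  -- Compares valuations: v(x) ≤ v(y) or v(x) ≥ v(y) + 1. The extra `π` in the second case is what
  -- later yields the contradiction.
  ∣-total : ∀ x y → x ∣ y ⊎ π * y ∣ x
  ∣-total x y with ≟0 y | ≟0 x
  ... | yes y≈0 | _ = inj₁ (∣ʳ-respʳ-≈ (sym y≈0) (x ∣0))
  ... | no _ | yes x≈0 = inj₂ (∣ʳ-respʳ-≈ (sym x≈0) ((π * y) ∣0))
  ... | no y≉0 | no x≉0 with factor x x≉0 | factor y y≉0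
  ...   | s , x∣πˢ , πˢ∣x | t , y∣πᵗ , πᵗ∣y with s ℕ.≤? t
  ...     | yes s≤t = inj₁ (∣ʳ-trans x∣πˢ (∣ʳ-trans (^-∣ s≤t) πᵗ∣y))
  ...     | no s≰t = inj₂ (∣ʳ-trans (x∣y⇒zx∣zy π y∣πᵗ) (∣ʳ-trans (^-∣ (ℕP.≰⇒> s≰t)) πˢ∣x))

  ^≉0 : ∀ t → ¬ (π ^ t ≈ 0#)
  ^≉0 ℕ.zero = 1≉0
  ^≉0 (ℕ.suc t) = *≉0 π≉0 (^≉0 t)

  -- Divisibility is total, so a smallest valuation is attained. The `Fin n` argument makes the
  -- family nonempty.
  least : ∀ {n} (w : Fin n → Carrier) → Fin n → ∃ λ k → ∀ i → w k ∣ w i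
  least {ℕ.suc ℕ.zero} w _ = zero , λ { zero → ∣ʳ-refl }
  least {ℕ.suc (ℕ.suc n)} w _ with least (w ∘ suc) zero
  ... | k , wₖ∣w with ∣-total (w zero) (w (suc k))
  ...   | inj₁ w₀∣wₖ = zero , λ { zero → ∣ʳ-refl ; (suc i) → ∣ʳ-trans w₀∣wₖ (wₖ∣w i) }
  ...   | inj₂ πwₖ∣w₀ = suc k , λ
          { zero → ∣ʳ-trans (x∣ʳyx _ π) πwₖ∣w₀ ; (suc i) → wₖ∣w i }

  -- If r π x = x then (r π - 1) x = 0, and cancelling `x` would make `π` a unit.
  πx∤x : ∀ {x} → ¬ (x ≈ 0#) → ¬ (π * x ∣ x)
  πx∤x {x} x≉0 (r , rπx≈x) with integral (r * π - 1#) x (begin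
    (r * π - 1#) * x    ≈⟨ distribʳ x (r * π) (- 1#) ⟩
    r * π * x + - 1# * x  ≈⟨ +-cong (trans (*-assoc r π x) rπx≈x) (-1*x≈-x x) ⟩
    x - x               ≈⟨ -‿inverseʳ x ⟩
    0#                  ∎)
  ... | inj₁ rπ-1≈0 = π∤1 (r , x∙y⁻¹≈ε⇒x≈y _ _ rπ-1≈0)
  ... | inj₂ x≈0 = x≉0 x≈0

  -- Linear dependence by fraction-free elimination

  eliminate : ∀ α w b x y → w * b * - x + α * w * y ≈ w * (α * y - b * x)
  eliminate α w b x y = begin
    w * b * - x + α * w * y        ≈⟨ +-comm _ _ ⟩
    α * w * y + w * b * - x
      ≈⟨ +-cong (trans (*-congʳ (*-comm α w)) (*-assoc w α y))
           (trans (*-assoc w b (- x)) (*-congˡ (sym (-‿distribʳ-* b x)))) ⟩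
    w * (α * y) + w * - (b * x)    ≈⟨ distribˡ w _ _ ⟨
    w * (α * y - b * x)            ∎

  Dependent : ∀ {n k} → (Fin n → Fin k → Carrier) → Set (c ⊔ ℓ)
  Dependent {n} A = Σ (Fin n → Carrier) λ w → (∃ λ i → ¬ (w i ≈ 0#)) × (∀ j → sum (λ i → w i * A i j) ≈ 0#)

  module Pivot {n k} (A : Fin (ℕ.suc n) → Fin (ℕ.suc k) → Carrier)
    (r : Fin (ℕ.suc n)) (α≉0 : ¬ (A r zero ≈ 0#)) where

    α : Carrier
    α = A r zero

    -- Rows are multiplied by the pivot `α` rather than divided by it, so the elimination stays
    -- inside the ring.
    B eliminated : Fin n → Fin (ℕ.suc k) → Carrier
    B t j = A (punchIn r t) j
    eliminated t j = α * B t j - B t zero * A r j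

    module _ (w : Fin n → Carrier) where
      S : Carrier
      S = sum (λ t → w t * B t zero)

      -- Expanding a combination of eliminated rows shows the weights carried by the original ones:
      -- `α * w t` on row `punchIn r t`, and `- S` on the pivot row.
      lifted : Fin (ℕ.suc n) → Carrier
      lifted = insertAt (λ t → α * w t) r (- S)

      lifted-pivot : lifted r ≈ - S
      lifted-pivot = reflexive (insertAt-lookup (λ t → α * w t) r (- S))

      lifted-punchIn : ∀ t → lifted (punchIn r t) ≈ α * w t
      lifted-punchIn t = reflexive (insertAt-punchIn (λ t → α * w t) r (- S) t)

      lifted-eliminated : ∀ j → sum (λ i → lifted i * A i j) ≈ sum (λ t → w t * eliminated t j)
      lifted-eliminated j = begin
        sum (λ i → lifted i * A i j)
          ≈⟨ sum-remove {i = r} (λ i → lifted i * A i j) ⟩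
        lifted r * A r j + sum (λ t → lifted (punchIn r t) * B t j)
          ≈⟨ +-cong (*-congʳ lifted-pivot) (sum-cong-≋ λ t → *-congʳ (lifted-punchIn t)) ⟩
        - S * A r j + sum (λ t → α * w t * B t j)
          ≈⟨ +-congʳ (trans (sym (-‿distribˡ-* S (A r j))) (-‿distribʳ-* S (A r j))) ⟩
        S * - A r j + sum (λ t → α * w t * B t j)
          ≈⟨ +-congʳ (*-distribʳ-sum (- A r j) (λ t → w t * B t zero)) ⟩
        sum (λ t → w t * B t zero * - A r j) + sum (λ t → α * w t * B t j)
          ≈⟨ ∑-distrib-+ (λ t → w t * B t zero * - A r j) (λ t → α * w t * B t j) ⟨
        sum (λ t → w t * B t zero * - A r j + α * w t * B t j)
          ≈⟨ sum-cong-≋ (λ t → eliminate α (w t) (B t zero) (A r j) (B t j)) ⟩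
        sum (λ t → w t * eliminated t j) ∎

    dependent : Dependent (λ t j → eliminated t (suc j)) → Dependent A
    dependent (w , (t , wₜ≉0) , wE≈0) =
      lifted w ,
      (punchIn r t , *≉0 α≉0 wₜ≉0 ∘ trans (sym (lifted-punchIn w t))) ,
      -- Column zero of the eliminated matrix is α b - b α, which vanishes by commutativity.
      λ { zero → trans (lifted-eliminated w zero) (∑-zero λ t →
            trans (*-congˡ (trans (+-congˡ (-‿cong (*-comm _ _))) (-‿inverseʳ _))) (zeroʳ (w t)))
        ; (suc j) → trans (lifted-eliminated w (suc j)) (wE≈0 j) }

  -- Induction on the number of columns. A nonzero entry of the first column serves as pivot and
  -- removes one row and one column; if there is none, every weight vector annihilates that column
  -- and it is dropped.
  dependence : ∀ {k n} → k ℕ.< n → (A : Fin n → Fin k → Carrier) → Dependent A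
  dependence {ℕ.zero} (s≤s _) A = (λ _ → 1#) , (zero , 1≉0) , λ ()
  dependence {ℕ.suc k} (s≤s k<n) A with any? (λ i → ¬? (≟0 (A i zero)))
  ... | yes (r , α≉0) = dependent (dependence k<n _)
    where open Pivot A r α≉0
  ... | no none with dependence (ℕP.m<n⇒m<1+n k<n) (λ i j → A i (suc j))
  ...   | w , w≉0 , wA≈0 = w , w≉0 , λ
          { zero → ∑-zero (λ i → trans
              (*-congˡ (decidable-stable (≟0 (A i zero)) (λ a≉0 → none (i , a≉0))))
              (zeroʳ (w i)))
          ; (suc j) → wA≈0 j }

-- Linear combinations in a module

module LinearCombinations {c ℓ m ℓm} {R : CommutativeRing c ℓ} (M : Module R m ℓm) where
  open CommutativeRing R hiding (zero)
  open Module M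
  open SemiringSum semiring using (sum)
  open MonoidSum +ᴹ-commutativeMonoid using (∑-comm)
    renaming (sum to sumᴹ; sum-cong-≋ to sumᴹ-cong; ∑-distrib-+ to sumᴹ-distrib-+)
  open SparseSums +-commutativeMonoid
  open SparseSums +ᴹ-commutativeMonoid using () renaming (∑-zero to ∑ᴹ-zero; ∑-single to ∑ᴹ-single)
  module ≈ᴹ-Reasoning = SetoidReasoning ≈ᴹ-setoid

  lc : ∀ {n} → (Fin n → Carrier) → (Fin n → Carrierᴹ) → Carrierᴹ
  lc a x = sumᴹ (λ i → a i *ₗ x i)

  lc-congʳ : ∀ {n} (a : Fin n → Carrier) {x y} → (∀ i → x i ≈ᴹ y i) → lc a x ≈ᴹ lc a y
  lc-congʳ a x≈y = sumᴹ-cong (λ i → *ₗ-congˡ (x≈y i))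

  *ₗ-comm-assoc : ∀ r s x → r *ₗ (s *ₗ x) ≈ᴹ s *ₗ (r *ₗ x)
  *ₗ-comm-assoc r s x = begin
    r *ₗ (s *ₗ x)   ≈⟨ *ₗ-assoc r s x ⟨
    (r * s) *ₗ x    ≈⟨ *ₗ-congʳ (*-comm r s) ⟩
    (s * r) *ₗ x    ≈⟨ *ₗ-assoc s r x ⟩
    s *ₗ (r *ₗ x)   ∎
    where open ≈ᴹ-Reasoning

  *ₗ-distribˡ-∑ : ∀ r {n} (x : Fin n → Carrierᴹ) → r *ₗ sumᴹ x ≈ᴹ sumᴹ (λ i → r *ₗ x i)
  *ₗ-distribˡ-∑ r {ℕ.zero} x = *ₗ-zeroʳ r
  *ₗ-distribˡ-∑ r {ℕ.suc n} x =
    ≈ᴹ-trans (*ₗ-distribˡ r _ _) (+ᴹ-congˡ (*ₗ-distribˡ-∑ r (x ∘ suc)))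

  *ₗ-distribʳ-∑ : ∀ x {n} (a : Fin n → Carrier) → sum a *ₗ x ≈ᴹ sumᴹ (λ i → a i *ₗ x)
  *ₗ-distribʳ-∑ x {ℕ.zero} a = *ₗ-zeroˡ x
  *ₗ-distribʳ-∑ x {ℕ.suc n} a =
    ≈ᴹ-trans (*ₗ-distribʳ x _ _) (+ᴹ-congˡ (*ₗ-distribʳ-∑ x (a ∘ suc)))

  *ₗ-lc : ∀ r {n} (a : Fin n → Carrier) x → r *ₗ lc a x ≈ᴹ lc (λ i → r * a i) x
  *ₗ-lc r a x = ≈ᴹ-trans (*ₗ-distribˡ-∑ r (λ i → a i *ₗ x i)) (sumᴹ-cong (λ i → ≈ᴹ-sym (*ₗ-assoc r (a i) (x i))))

  *ₗ-lcʳ : ∀ r {n} (a : Fin n → Carrier) x → r *ₗ lc a x ≈ᴹ lc a (λ i → r *ₗ x i)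
  *ₗ-lcʳ r a x = ≈ᴹ-trans (*ₗ-distribˡ-∑ r (λ i → a i *ₗ x i)) (sumᴹ-cong (λ i → *ₗ-comm-assoc r (a i) (x i)))

  lc-+ : ∀ {n} (a b : Fin n → Carrier) x → lc (λ i → a i + b i) x ≈ᴹ lc a x +ᴹ lc b x
  lc-+ a b x = ≈ᴹ-trans (sumᴹ-cong (λ i → *ₗ-distribʳ (x i) (a i) (b i)))
    (sumᴹ-distrib-+ (λ i → a i *ₗ x i) (λ i → b i *ₗ x i))

  lc-∑ : ∀ {k n} (u : Fin k → Fin n → Carrier) x →
         lc (λ l → sum (λ j → u j l)) x ≈ᴹ sumᴹ (λ j → lc (u j) x)
  lc-∑ u x = ≈ᴹ-trans (sumᴹ-cong (λ l → *ₗ-distribʳ-∑ (x l) (λ j → u j l)))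
    (∑-comm (λ l j → u j l *ₗ x l))

  lc-lc : ∀ {k n} (d : Fin k → Carrier) (u : Fin k → Fin n → Carrier) x →
          lc d (λ j → lc (u j) x) ≈ᴹ lc (λ l → sum (λ j → d j * u j l)) x
  lc-lc d u x = ≈ᴹ-trans (sumᴹ-cong (λ j → *ₗ-lc (d j) (u j) x))
    (≈ᴹ-sym (lc-∑ (λ j l → d j * u j l) x))

  single : ∀ {n} → Fin n → Carrier → Fin n → Carrier
  single k r l = if does (k Fin.≟ l) then r else 0#

  single-≡ : ∀ {n} {k l : Fin n} r → k ≡ l → single k r l ≈ r
  single-≡ {k = k} {l} r k≡l with k Fin.≟ l
  ... | yes _ = refl
  ... | no k≢l = ⊥-elim (k≢l k≡l)

  single-≢ : ∀ {n} {k l : Fin n} r → k ≢ l → single k r l ≈ 0#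
  single-≢ {k = k} {l} r k≢l with k Fin.≟ l
  ... | yes k≡l = ⊥-elim (k≢l k≡l)
  ... | no _ = refl

  lc-single : ∀ {n} (k : Fin n) r x → lc (single k r) x ≈ᴹ r *ₗ x k
  lc-single k r x = ≈ᴹ-trans
    (∑ᴹ-single (λ l → single k r l *ₗ x l) k λ l l≢k →
      ≈ᴹ-trans (*ₗ-congʳ (single-≢ r (l≢k ∘ ≡.sym))) (*ₗ-zeroˡ (x l)))
    (*ₗ-congʳ (single-≡ {k = k} r ≡.refl))

  -- Pushforward of a coefficient vector along `σ`: the entry at `l` collects the coefficients over
  -- the fibre above `l`, so `σ` may identify indices.
  push : ∀ {n s} → (Fin n → Fin s) → (Fin n → Carrier) → Fin s → Carrier
  push σ e l = sum (λ i → single (σ i) (e i) l)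

  lc-push : ∀ {n s} (σ : Fin n → Fin s) e x → lc (push σ e) x ≈ᴹ lc e (x ∘ σ)
  lc-push σ e x = ≈ᴹ-trans (lc-∑ (λ i → single (σ i) (e i)) x)
    (sumᴹ-cong (λ i → lc-single (σ i) (e i) x))

  push-image : ∀ {n s} (σ : Fin n → Fin s) e → (∀ i j → σ i ≡ σ j → i ≡ j) →
               ∀ i → push σ e (σ i) ≈ e i
  push-image σ e σ-inj i = trans
    (∑-single (λ j → single (σ j) (e j) (σ i)) i (λ j j≢i → single-≢ (e j) (j≢i ∘ σ-inj j i)))
    (single-≡ {k = σ i} (e i) ≡.refl)

  push-outside : ∀ {n s} (σ : Fin n → Fin s) e l → (∀ i → σ i ≢ l) → push σ e l ≈ 0#
  push-outside σ e l l∉σ = ∑-zero (λ i → single-≢ (e i) (l∉σ i))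

  LinearlyIndependent : ∀ {n} → (Fin n → Carrierᴹ) → Set (c ⊔ ℓ ⊔ ℓm)
  LinearlyIndependent x = ∀ a → lc a x ≈ᴹ 0ᴹ → ∀ i → a i ≈ 0#

  coefficients-unique : ∀ {n} {x : Fin n → Carrierᴹ} → LinearlyIndependent x →
    ∀ a b → lc a x ≈ᴹ lc b x → ∀ i → a i ≈ b i
  coefficients-unique {x = x} indep a b a≈b i = x∙y⁻¹≈ε⇒x≈y _ _ (indep (λ i → a i - b i) (begin
    lc (λ i → a i - b i) x            ≈⟨ lc-+ a (λ i → - b i) x ⟩
    lc a x +ᴹ lc (λ i → - b i) x      ≈⟨ +ᴹ-congʳ a≈b ⟩
    lc b x +ᴹ lc (λ i → - b i) x      ≈⟨ lc-+ b (λ i → - b i) x ⟨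
    lc (λ i → b i - b i) x            ≈⟨ ∑ᴹ-zero (λ i → ≈ᴹ-trans (*ₗ-congʳ (-‿inverseʳ (b i))) (*ₗ-zeroˡ (x i))) ⟩
    0ᴹ ∎) i)
    where
    open RingProperties ring
    open ≈ᴹ-Reasoning

  -- If `x i` and `x j` agree, the standard basis vectors at `i` and `j` give the same combination,
  -- so uniqueness of coefficients identifies them.
  independent-injective : ¬ (1# ≈ 0#) → ∀ {n} {x : Fin n → Carrierᴹ} →
    LinearlyIndependent x → ∀ i j → x i ≈ᴹ x j → i ≡ j
  independent-injective 1≉0 {x = x} indep i j xᵢ≈xⱼ =
    decidable-stable (i Fin.≟ j) λ i≢j → 1≉0 (begin
      1#              ≈⟨ single-≡ {k = i} 1# ≡.refl ⟨
      single i 1# i   ≈⟨ coefficients-unique indep (single i 1#) (single j 1#) combinations≈ i ⟩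
      single j 1# i   ≈⟨ single-≢ {k = j} 1# (i≢j ∘ ≡.sym) ⟩
      0#              ∎)
    where
    open SetoidReasoning setoid
    combinations≈ : lc (single i 1#) x ≈ᴹ lc (single j 1#) x
    combinations≈ = ≈ᴹ-trans (lc-single i 1# x)
      (≈ᴹ-trans (*ₗ-congˡ xᵢ≈xⱼ) (≈ᴹ-sym (lc-single j 1# x)))

  -- One common denominator `a` serves the whole family, so it can be cleared from a linear
  -- combination of the `x i` at once.
  Spans⁰ : ∀ {n k} → (Fin n → Carrierᴹ) → (Fin k → Carrierᴹ) → Set (c ⊔ ℓ ⊔ ℓm)
  Spans⁰ y x = ∃ λ a → ¬ (a ≈ 0#) × (∀ i → ∃ λ e → a *ₗ x i ≈ᴹ lc e y)

  -- Heights and Ulm sequences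

  module Heights {i h} {I : Set i} (H : I → Carrierᴹ → Set h)
    (H-resp : ∀ a {x y} → x ≈ᴹ y → H a x → H a y)
    (H-scale : ∀ a r {x} → H a x → H a (r *ₗ x)) where

    open SemiringDivisibility semiring

    infix 4 _≍_
    -- Heights are compared through membership alone. With `H a` read as p^α G, an implication from
    -- `H a x` to `H a y` for all `a` says |x| ≤ |y|, the value ∞ included.
    _≍_ : Carrierᴹ → Carrierᴹ → Set (i ⊔ h)
    x ≍ y = ∀ a → (H a x → H a y) × (H a y → H a x)

    ≍-reflexive : ∀ {x y} → x ≈ᴹ y → x ≍ y
    ≍-reflexive x≈y a = H-resp a x≈y , H-resp a (≈ᴹ-sym x≈y)

    ≍-setoid : Setoid m (i ⊔ h)
    ≍-setoid = record
      { Carrier = Carrierᴹ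
      ; _≈_ = _≍_
      ; isEquivalence = record
        { refl = ≍-reflexive ≈ᴹ-refl
        ; sym = λ x≍y a → swap (x≍y a)
        ; trans = λ x≍y y≍z a → proj₁ (y≍z a) ∘ proj₁ (x≍y a) , proj₂ (x≍y a) ∘ proj₂ (y≍z a) } }

    ∣-height : ∀ {r s} x → r ∣ s → ∀ a → H a (r *ₗ x) → H a (s *ₗ x)
    ∣-height {r} x (q , qr≈s) a hrx =
      H-resp a (≈ᴹ-trans (≈ᴹ-sym (*ₗ-assoc q r x)) (*ₗ-congʳ qr≈s)) (H-scale a q hrx)

    ∥⇒≍ : ∀ {r s} x → r ∥ s → r *ₗ x ≍ s *ₗ x
    ∥⇒≍ x (r∣s , s∣r) a = ∣-height x r∣s a , ∣-height x s∣r a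

    IsMinimum : ∀ {n} → Carrierᴹ → (Fin n → Carrierᴹ) → Set (i ⊔ h)
    IsMinimum y z = ∀ a → (H a y → ∀ i → H a (z i)) × ((∀ i → H a (z i)) → H a y)

    HeightIndependent : ∀ {n} → (Fin n → Carrierᴹ) → Set (c ⊔ i ⊔ h)
    HeightIndependent x = ∀ e → IsMinimum (lc e x) (λ j → e j *ₗ x j)

    module UlmSequences {π : Carrier} (dvr : IsDiscreteValuationRing R π) where
      open IsDiscreteValuationRing dvr
      open DiscreteValuation dvr
      open SemiringExp semiring
      open CommutativeSemigroupDivisibility *-commutativeSemigroup using (x∣y⇒zx∣zy)
      module ≍-Reasoning = SetoidReasoning ≍-setoid

      infix 4 _∼_
      _∼_ : Carrierᴹ → Carrierᴹ → Set (i ⊔ h)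
      x ∼ y = Σ ℕ λ k → Σ ℕ λ l → 0 ℕ.< k × 0 ℕ.< l ×
              (∀ t → π ^ (t ℕ.+ l) *ₗ x ≍ π ^ (t ℕ.+ k) *ₗ y)

      *ₗ-^-+ : ∀ k l x → π ^ (k ℕ.+ l) *ₗ x ≈ᴹ π ^ k *ₗ (π ^ l *ₗ x)
      *ₗ-^-+ k l x = ≈ᴹ-trans (*ₗ-congʳ (^-homo-* π k l)) (*ₗ-assoc _ _ x)

      ∥-scale : ∀ t {r s} → r ∥ s → t * r ∥ t * s
      ∥-scale t (r∣s , s∣r) = x∣y⇒zx∣zy t r∣s , x∣y⇒zx∣zy t s∣r

      -- Each equivalence matches a tail of the sequence of `x j` with the tail of that of `g` from
      -- `κ j` on. Shifting further to a bound `μ` of all `κ j` gives one common tail.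
      align : ∀ {n} (x : Fin n → Carrierᴹ) g → (∀ j → x j ∼ g) →
        ∃ λ μ → Σ (Fin n → ℕ) λ ν → ∀ j k → π ^ k *ₗ (π ^ ν j *ₗ x j) ≍ π ^ k *ₗ (π ^ μ *ₗ g)
      align x g x∼g = μ , ν , aligned
        where
        κ ι : Fin _ → ℕ
        κ j = proj₁ (x∼g j)
        ι j = proj₁ (proj₂ (x∼g j))
        μ = proj₁ (bounded κ)
        ν : Fin _ → ℕ
        -- Since `κ j` is at most `μ`, the truncated difference is the exact further shift.
        ν j = μ ℕ.∸ κ j ℕ.+ ι j
        aligned : ∀ j k → π ^ k *ₗ (π ^ ν j *ₗ x j) ≍ π ^ k *ₗ (π ^ μ *ₗ g)
        aligned j k = begin
          π ^ k *ₗ (π ^ ν j *ₗ x j)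
            ≈⟨ ≍-reflexive (*ₗ-^-+ k (ν j) (x j)) ⟨
          π ^ (k ℕ.+ ν j) *ₗ x j
            ≡⟨ ≡.cong (λ t → π ^ t *ₗ x j) (ℕP.+-assoc k (μ ℕ.∸ κ j) (ι j)) ⟨
          π ^ (k ℕ.+ (μ ℕ.∸ κ j) ℕ.+ ι j) *ₗ x j
            ≈⟨ proj₂ (proj₂ (proj₂ (proj₂ (x∼g j)))) (k ℕ.+ (μ ℕ.∸ κ j)) ⟩
          π ^ (k ℕ.+ (μ ℕ.∸ κ j) ℕ.+ κ j) *ₗ g
            ≡⟨ ≡.cong (λ t → π ^ t *ₗ g) (≡.trans (ℕP.+-assoc k _ (κ j))
                 (≡.cong (k ℕ.+_) (ℕP.m∸n+n≡m (proj₂ (bounded κ) j)))) ⟩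
          π ^ (k ℕ.+ μ) *ₗ g
            ≈⟨ ≍-reflexive (*ₗ-^-+ k μ g) ⟩
          π ^ k *ₗ (π ^ μ *ₗ g) ∎
          where open ≍-Reasoning

      -- A nonzero `r` is associate to a power of `π`, and associate scalars give multiples of equal
      -- height; a zero `r` sends both elements to zero.
      ≍-multiples : ∀ {x y} → (∀ k → π ^ k *ₗ x ≍ π ^ k *ₗ y) → ∀ r → r *ₗ x ≍ r *ₗ y
      ≍-multiples {x} {y} x≍y r with ≟0 r
      ... | yes r≈0 = ≍-reflexive (≈ᴹ-trans (vanish x) (≈ᴹ-sym (vanish y)))
        where
        vanish : ∀ z → r *ₗ z ≈ᴹ 0ᴹ
        vanish z = ≈ᴹ-trans (*ₗ-congʳ r≈0) (*ₗ-zeroˡ z)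
      ... | no r≉0 with factor r r≉0
      ...   | k , r∥πᵏ = begin
        r *ₗ x       ≈⟨ ∥⇒≍ x r∥πᵏ ⟩
        π ^ k *ₗ x   ≈⟨ x≍y k ⟩
        π ^ k *ₗ y   ≈⟨ ∥⇒≍ y r∥πᵏ ⟨
        r *ₗ y       ∎
        where open ≍-Reasoning

      -- Replacing `β` and `q` by associated powers of `π` turns the last hypothesis into a match of
      -- shifted Ulm sequences; that of `x` is in turn the sequence of `g` shifted by `μ`.
      ∼-intro : ∀ {y x g β q μ} → ¬ (β ≈ 0#) → ¬ (q ≈ 0#) →
        (∀ r → r *ₗ x ≍ r *ₗ (π ^ μ *ₗ g)) →
        (∀ k → (π ^ k * β) *ₗ y ≍ (π ^ k * q) *ₗ x) → y ∼ g
      ∼-intro {y} {x} {g} {β} {q} {μ} β≉0 q≉0 x≍g y≍x with factor β β≉0 | factor q q≉0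
      -- Both shifts are raised by one because `_∼_` asks for positive ones; accordingly `y≍x` is
      -- used at `ℕ.suc k`.
      ... | s , β∥πˢ | t , q∥πᵗ = ℕ.suc (t ℕ.+ μ) , ℕ.suc s , s≤s z≤n , s≤s z≤n , λ k → begin
        π ^ (k ℕ.+ ℕ.suc s) *ₗ y
          ≡⟨ ≡.cong (λ e → π ^ e *ₗ y) (ℕP.+-suc k s) ⟩
        π ^ (ℕ.suc k ℕ.+ s) *ₗ y
          ≈⟨ ≍-reflexive (*ₗ-congʳ (^-homo-* π (ℕ.suc k) s)) ⟩
        (π ^ ℕ.suc k * π ^ s) *ₗ y
          ≈⟨ ∥⇒≍ y (∥-scale (π ^ ℕ.suc k) β∥πˢ) ⟨
        (π ^ ℕ.suc k * β) *ₗ y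
          ≈⟨ y≍x (ℕ.suc k) ⟩
        (π ^ ℕ.suc k * q) *ₗ x
          ≈⟨ ∥⇒≍ x (∥-scale (π ^ ℕ.suc k) q∥πᵗ) ⟩
        (π ^ ℕ.suc k * π ^ t) *ₗ x
          ≈⟨ x≍g (π ^ ℕ.suc k * π ^ t) ⟩
        (π ^ ℕ.suc k * π ^ t) *ₗ (π ^ μ *ₗ g)
          ≈⟨ ≍-reflexive (*ₗ-congʳ (^-homo-* π (ℕ.suc k) t)) ⟨
        π ^ (ℕ.suc k ℕ.+ t) *ₗ (π ^ μ *ₗ g)
          ≈⟨ ≍-reflexive (*ₗ-^-+ (ℕ.suc k ℕ.+ t) μ g) ⟨
        π ^ (ℕ.suc k ℕ.+ t ℕ.+ μ) *ₗ g
          ≡⟨ ≡.cong (λ e → π ^ e *ₗ g) (≡.trans (≡.cong ℕ.suc (ℕP.+-assoc k t μ)) (≡.sym (ℕP.+-suc k (t ℕ.+ μ)))) ⟩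
        π ^ (k ℕ.+ ℕ.suc (t ℕ.+ μ)) *ₗ g ∎
        where open ≍-Reasoning

      -- The product `a * a₀` is a common denominator: `a₀` clears the new element and `a` the old
      -- ones, whose combinations are carried from `y` to `y′` along `τ`.
      spans⁰-extend : ∀ {n k k′} {x : Fin (ℕ.suc n) → Carrierᴹ}
        {y : Fin k → Carrierᴹ} {y′ : Fin k′ → Carrierᴹ} →
        (∀ j → ∃ λ l → y j ≈ᴹ y′ l) → Spans⁰ y (x ∘ suc) →
        (∃ λ a → ¬ (a ≈ 0#) × ∃ λ e → a *ₗ x zero ≈ᴹ lc e y′) → Spans⁰ y′ x
      spans⁰-extend {x = x} {y} {y′} y⊆y′ (a , a≉0 , span) (a₀ , a₀≉0 , e₀ , a₀x≈) =
        a * a₀ , *≉0 a≉0 a₀≉0 , λ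
          { zero → (λ l → a * e₀ l) , ≈ᴹ-trans (*ₗ-assoc a a₀ (x zero)) (≈ᴹ-trans (*ₗ-congˡ a₀x≈) (*ₗ-lc a e₀ y′))
          ; (suc j) → (λ l → a₀ * push τ (proj₁ (span j)) l) , (begin
              (a * a₀) *ₗ x (suc j)                   ≈⟨ *ₗ-assoc a a₀ (x (suc j)) ⟩
              a *ₗ (a₀ *ₗ x (suc j))                  ≈⟨ *ₗ-comm-assoc a a₀ (x (suc j)) ⟩
              a₀ *ₗ (a *ₗ x (suc j))                  ≈⟨ *ₗ-congˡ (proj₂ (span j)) ⟩
              a₀ *ₗ lc (proj₁ (span j)) y             ≈⟨ *ₗ-congˡ (lc-congʳ (proj₁ (span j)) (λ l → proj₂ (y⊆y′ l))) ⟩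
              a₀ *ₗ lc (proj₁ (span j)) (y′ ∘ τ)      ≈⟨ *ₗ-congˡ (lc-push τ (proj₁ (span j)) y′) ⟨
              a₀ *ₗ lc (push τ (proj₁ (span j))) y′   ≈⟨ *ₗ-lc a₀ (push τ (proj₁ (span j))) y′ ⟩
              lc (λ l → a₀ * push τ (proj₁ (span j)) l) y′ ∎) }
        where
        open ≈ᴹ-Reasoning
        τ : Fin _ → Fin _
        τ l = proj₁ (y⊆y′ l)

-- The exchange argument

module Comparison {c ℓ m ℓm i h} {R : CommutativeRing c ℓ} (M : Module R m ℓm)
  {I : Set i} (H : I → Module.Carrierᴹ M → Set h)
  (H-resp : ∀ a {x y} → Module._≈ᴹ_ M x y → H a x → H a y)
  (H-scale : ∀ a r {x} → H a x → H a (Module._*ₗ_ M r x))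
  {π : CommutativeRing.Carrier R} (dvr : IsDiscreteValuationRing R π) where
  open CommutativeRing R hiding (zero)
  open Module M
  open LinearCombinations M
  open Heights H H-resp H-scale
  open UlmSequences dvr
  open IsDiscreteValuationRing dvr
  open DiscreteValuation dvr
  open SemiringDivisibility semiring
  open CommutativeSemigroupDivisibility *-commutativeSemigroup using (x∣y⇒zx∣zy)
  open SemiringExp semiring
  open SemiringSum semiring using (sum; sum-cong-≋)
  open SparseSums +-commutativeMonoid

  -- The parameters are jointly impossible: `χ` would list fewer than `n` indices and yet meet every
  -- `j` with `y j` in the class of `g`.
  module Exchange {n s t k} {x : Fin s → Carrierᴹ} {y : Fin t → Carrierᴹ} {g : Carrierᴹ}
    (x-independent : LinearlyIndependent x)
    (x-height : HeightIndependent x) (y-height : HeightIndependent y)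
    {σ : Fin n → Fin s} (σ-injective : ∀ j l → σ j ≡ σ l → j ≡ l)
    (xσ∼g : ∀ j → x (σ j) ∼ g)
    {a} (a≉0 : ¬ (a ≈ 0#)) {e : Fin n → Fin t → Carrier}
    (ax≈ : ∀ j → a *ₗ x (σ j) ≈ᴹ lc (e j) y)
    {b} (b≉0 : ¬ (b ≈ 0#)) {u : Fin t → Fin s → Carrier}
    (by≈ : ∀ j → b *ₗ y j ≈ᴹ lc (u j) x)
    (k<n : k ℕ.< n) {χ : Fin k → Fin t} (cover : ∀ j → y j ∼ g → ∃ λ l → χ l ≡ j) where

    μ : ℕ
    μ = proj₁ (align (x ∘ σ) g xσ∼g)

    ν : Fin n → ℕ
    ν = proj₁ (proj₂ (align (x ∘ σ) g xσ∼g))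

    x′ : Fin n → Carrierᴹ
    x′ j = π ^ ν j *ₗ x (σ j)

    x′≍g : ∀ j r → r *ₗ x′ j ≍ r *ₗ (π ^ μ *ₗ g)
    x′≍g j = ≍-multiples (proj₂ (proj₂ (align (x ∘ σ) g xσ∼g)) j)

    -- Entry (j, l) is the coefficient of `y (χ l)` in the expansion of `a *ₗ x′ j`. The weights
    -- therefore cancel every coordinate listed by `χ`.
    relation : Dependent (λ j l → π ^ ν j * e j (χ l))
    relation = dependence k<n _

    w : Fin n → Carrier
    w = proj₁ relation

    leading : ∃ λ o → ∀ j → w o ∣ w j
    leading = least w (proj₁ (proj₁ (proj₂ relation)))

    o : Fin n
    o = proj₁ leading

    wₒ≉0 : ¬ (w o ≈ 0#)
    wₒ≉0 = x∣y∧y≉0⇒x≉0 (proj₂ leading (proj₁ (proj₁ (proj₂ relation))))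
                       (proj₂ (proj₁ (proj₂ relation)))

    v : Fin n → Carrier
    v j = w j * π ^ ν j

    z : Carrierᴹ
    z = lc v (x ∘ σ)

    d : Fin t → Carrier
    d l = sum (λ j → v j * e j l)

    az≈ : a *ₗ z ≈ᴹ lc d y
    az≈ = begin
      a *ₗ lc v (x ∘ σ)                ≈⟨ *ₗ-lcʳ a v (x ∘ σ) ⟩
      lc v (λ j → a *ₗ x (σ j))        ≈⟨ lc-congʳ v ax≈ ⟩
      lc v (λ j → lc (e j) y)          ≈⟨ lc-lc v e y ⟩
      lc d y                           ∎
      where open ≈ᴹ-Reasoning

    d∘χ≈0 : ∀ l → d (χ l) ≈ 0#
    d∘χ≈0 l = trans (sum-cong-≋ (λ j → *-assoc (w j) (π ^ ν j) (e j (χ l))))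
      (proj₂ (proj₂ relation) l)

    rz≈ : ∀ r → r *ₗ z ≈ᴹ lc (push σ (λ j → r * v j)) x
    rz≈ r = ≈ᴹ-trans (*ₗ-lc r v (x ∘ σ)) (≈ᴹ-sym (lc-push σ (λ j → r * v j) x))

    push-*ₗ : ∀ r j → push σ (λ j → r * v j) (σ j) *ₗ x (σ j) ≈ᴹ (r * w j) *ₗ x′ j
    push-*ₗ r j = begin
      push σ (λ j → r * v j) (σ j) *ₗ x (σ j)
        ≈⟨ *ₗ-congʳ (push-image σ (λ j → r * v j) σ-injective j) ⟩
      (r * (w j * π ^ ν j)) *ₗ x (σ j)    ≈⟨ *ₗ-congʳ (*-assoc r (w j) (π ^ ν j)) ⟨
      (r * w j * π ^ ν j) *ₗ x (σ j)      ≈⟨ *ₗ-assoc (r * w j) (π ^ ν j) (x (σ j)) ⟩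
      (r * w j) *ₗ x′ j                   ∎
      where open ≈ᴹ-Reasoning

    -- The height of `r *ₗ z` is the minimum over the components `(r * w j) *ₗ x′ j`. The `x′ j`
    -- share one Ulm sequence and `w o` divides every `w j`, so the minimum occurs at `o`.
    z≍ : ∀ r → r *ₗ z ≍ (r * w o) *ₗ x′ o
    z≍ r p = to , from
      where
      to : H p (r *ₗ z) → H p ((r * w o) *ₗ x′ o)
      to hz = H-resp p (push-*ₗ r o)
        (proj₁ (x-height (push σ (λ j → r * v j)) p) (H-resp p (rz≈ r) hz) (σ o))
      from : H p ((r * w o) *ₗ x′ o) → H p (r *ₗ z)
      from hx = H-resp p (≈ᴹ-sym (rz≈ r)) (proj₂ (x-height (push σ (λ j → r * v j)) p) component)
        where
        component : ∀ l → H p (push σ (λ j → r * v j) l *ₗ x l)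
        component l with any? (λ j → σ j Fin.≟ l)
        -- The detour through `g` replaces `x′ o` by `x′ j` under the multiplier `r * w o`, which
        -- divides `r * w j`.
        ... | yes (j , ≡.refl) = H-resp p (≈ᴹ-sym (push-*ₗ r j))
                (∣-height (x′ j) (x∣y⇒zx∣zy r (proj₂ leading j)) p
                  (proj₂ (x′≍g j (r * w o) p) (proj₁ (x′≍g o (r * w o) p) hx)))
        -- A coordinate outside the image of `σ` is zero, and zero satisfies `H p` as the zero
        -- multiple of the element in `hx`.
        ... | no l∉σ = H-resp p
                (≈ᴹ-trans (*ₗ-zeroˡ _) (≈ᴹ-sym (≈ᴹ-trans
                  (*ₗ-congʳ (push-outside σ (λ j → r * v j) l (λ j σj≡l → l∉σ (j , σj≡l))))
                  (*ₗ-zeroˡ (x l)))))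
                (H-scale p 0# hx)

    q : Carrier
    q = b * a * v o

    q≉0 : ¬ (q ≈ 0#)
    q≉0 = *≉0 (*≉0 b≉0 a≉0) (*≉0 wₒ≉0 (^≉0 (ν o)))

    -- A squeeze of heights. The `x`-expansion of `b *ₗ y j` together with divisibility gives `to`;
    -- the `y`-expansion of `a *ₗ z` gives `from`.
    ∣q⇒∼ : ∀ j → d j * u j (σ o) ∣ q → y j ∼ g
    -- The factor `π ^ ν o` of `q` is absorbed into `x′ o`, so the multiplier passed on is
    -- `b * a * w o`.
    ∣q⇒∼ j du∣q = ∼-intro {μ = μ} (*≉0 b≉0 dⱼ≉0) (*≉0 (*≉0 b≉0 a≉0) wₒ≉0) (x′≍g o)
      λ κ p → to (π ^ κ) p , from (π ^ κ) p
      where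
      open ≈ᴹ-Reasoning
      dⱼ≉0 : ¬ (d j ≈ 0#)
      dⱼ≉0 d≈0 = x∣y∧y≉0⇒x≉0 du∣q q≉0 (trans (*-congʳ d≈0) (zeroˡ _))
      expand : ∀ r → (r * (b * d j)) *ₗ y j ≈ᴹ lc (λ l → r * d j * u j l) x
      expand r = begin
        (r * (b * d j)) *ₗ y j         ≈⟨ *ₗ-congʳ (trans (*-congˡ (*-comm b (d j))) (sym (*-assoc r (d j) b))) ⟩
        (r * d j * b) *ₗ y j           ≈⟨ *ₗ-assoc (r * d j) b (y j) ⟩
        (r * d j) *ₗ (b *ₗ y j)        ≈⟨ *ₗ-congˡ (by≈ j) ⟩
        (r * d j) *ₗ lc (u j) x        ≈⟨ *ₗ-lc (r * d j) (u j) x ⟩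
        lc (λ l → r * d j * u j l) x   ∎
      to : ∀ r p → H p ((r * (b * d j)) *ₗ y j) → H p ((r * (b * a * w o)) *ₗ x′ o)
      to r p hy = H-resp p
        (begin
          (r * q) *ₗ x (σ o)
            ≈⟨ *ₗ-congʳ (trans (*-congˡ (sym (*-assoc (b * a) (w o) (π ^ ν o))))
                 (sym (*-assoc r (b * a * w o) (π ^ ν o)))) ⟩
          (r * (b * a * w o) * π ^ ν o) *ₗ x (σ o)
            ≈⟨ *ₗ-assoc (r * (b * a * w o)) (π ^ ν o) (x (σ o)) ⟩
          (r * (b * a * w o)) *ₗ x′ o ∎)
        (∣-height (x (σ o)) (x∣y⇒zx∣zy r du∣q) p
          (H-resp p (*ₗ-congʳ (*-assoc r (d j) (u j (σ o))))
            (proj₁ (x-height (λ l → r * d j * u j l) p) (H-resp p (expand r) hy) (σ o))))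
      from : ∀ r p → H p ((r * (b * a * w o)) *ₗ x′ o) → H p ((r * (b * d j)) *ₗ y j)
      from r p hx = H-resp p (*ₗ-congʳ (*-assoc r b (d j)))
        (proj₁ (y-height (λ l → r * b * d l) p)
          (H-resp p
            (begin
              (r * (b * a)) *ₗ z         ≈⟨ *ₗ-congʳ (*-assoc r b a) ⟨
              (r * b * a) *ₗ z           ≈⟨ *ₗ-assoc (r * b) a z ⟩
              (r * b) *ₗ (a *ₗ z)        ≈⟨ *ₗ-congˡ az≈ ⟩
              (r * b) *ₗ lc d y          ≈⟨ *ₗ-lc (r * b) d y ⟩
              lc (λ l → r * b * d l) y   ∎)
            (proj₂ (z≍ (r * (b * a)) p)
              (H-resp p (*ₗ-congʳ (sym (*-assoc r (b * a) (w o)))) hx)))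
          j)

    -- Both sides are the coefficient of `x (σ o)` in `b *ₗ (a *ₗ z)`, expanded once directly and
    -- once through `y`; independence of `x` identifies them.
    q≈ : q ≈ sum (λ j → d j * u j (σ o))
    q≈ = trans (sym (push-image σ (λ j → b * a * v j) σ-injective o))
      (coefficients-unique x-independent _ _ (begin
        lc (push σ (λ j → b * a * v j)) x        ≈⟨ rz≈ (b * a) ⟨
        (b * a) *ₗ z                             ≈⟨ *ₗ-assoc b a z ⟩
        b *ₗ (a *ₗ z)                            ≈⟨ *ₗ-congˡ az≈ ⟩
        b *ₗ lc d y                              ≈⟨ *ₗ-lcʳ b d y ⟩
        lc d (λ j → b *ₗ y j)                    ≈⟨ lc-congʳ d by≈ ⟩
        lc d (λ j → lc (u j) x)                  ≈⟨ lc-lc d u x ⟩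
        lc (λ l → sum (λ j → d j * u j l)) x     ∎)
        (σ o))
      where open ≈ᴹ-Reasoning

    -- Otherwise the term divides `q`, which puts `y j` in the class of `g` and `j` among the values
    -- of `χ`. There `d` vanishes by the choice of weights, and everything divides zero.
    πq∣ : ∀ j → π * q ∣ d j * u j (σ o)
    πq∣ j with ∣-total (d j * u j (σ o)) q
    ... | inj₂ πq∣du = πq∣du
    ... | inj₁ du∣q with cover j (∣q⇒∼ j du∣q)
    ...   | l , ≡.refl = ∣ʳ-respʳ-≈ (sym (trans (*-congʳ (d∘χ≈0 l)) (zeroˡ _))) ((π * q) ∣0)

    contradiction : ⊥
    contradiction = πx∤x q≉0 (∣ʳ-respʳ-≈ (sym q≈) (∣-∑ πq∣))

-- The localised integers as a discrete valuation ring

∥-step : ∀ {c ℓ} (R : CommutativeRing c ℓ) → let open CommutativeRing R in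
  let open SemiringDivisibility semiring; open SemiringExp semiring in
  ∀ π x y t → x ≈ π * y → y ∥ (π ^ t) → x ∥ (π ^ ℕ.suc t)
∥-step R π x y t x≈πy (y∣πᵗ , πᵗ∣y) =
  ∣ʳ-respˡ-≈ (sym x≈πy) (x∣y⇒zx∣zy π y∣πᵗ) , ∣ʳ-respʳ-≈ (sym x≈πy) (x∣y⇒zx∣zy π πᵗ∣y)
  where
  open CommutativeRing R
  open SemiringDivisibility semiring
  open CommutativeSemigroupDivisibility *-commutativeSemigroup using (x∣y⇒zx∣zy)

module LocalisedIntegers (p : ℕ) (pr : Prime p) where
  open Localisation p pr
  open CommutativeRing (ℤ[ p ] pr) using (semiring)
  open SemiringDivisibility semiring using (_∥_; _,_)
  open SemiringExp semiring using (_^_)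

  πₚ : Carrierₚ
  πₚ = fromℕₚ p

  -- Since `p` does not divide the numerator, the reciprocal lies in the localisation again.
  -- Denominators are positive, so a negative sign moves to the numerator of the reciprocal.
  unit : ∀ a b (h : ¬ (p ℕD.∣ ℕ.suc b)) → ¬ (p ℕD.∣ ℤ.∣ a ∣) → (mkℚᵘ a b , h) ∥ 1ₚ
  unit +0 b h p∤a = ⊥-elim (p∤a (p ℕD.∣0))
  unit +[1+ a ] b h p∤a =
    ((mkℚᵘ +[1+ b ] a , p∤a) , QP.*-inverseˡ (mkℚᵘ +[1+ a ] b)) ,
    ((mkℚᵘ +[1+ a ] b , h) , QP.*-identityʳ (mkℚᵘ +[1+ a ] b))
  unit -[1+ a ] b h p∤a =
    ((mkℚᵘ -[1+ b ] a , p∤a) , QP.*-inverseˡ (mkℚᵘ -[1+ a ] b)) ,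
    ((mkℚᵘ -[1+ a ] b , h) , QP.*-identityʳ (mkℚᵘ -[1+ a ] b))

  -- Factors `p` are stripped off the numerator until a unit remains. The absolute value drops each
  -- time because p > 1 and the cofactor is nonzero.
  factorₚ : ∀ a b (h : ¬ (p ℕD.∣ ℕ.suc b)) → Acc ℕ._<_ ℤ.∣ a ∣ → a ≢ +0 →
            ∃ λ t → (mkℚᵘ a b , h) ∥ (πₚ ^ t)
  factorₚ a b h (acc rec) a≢0 with p ℕD.∣? ℤ.∣ a ∣
  ... | no p∤a = 0 , unit a b h p∤a
  ... | yes p∣a with ℤS.∣ᵤ⇒∣ {+ p} {a} p∣a
  ...   | ℤS.divides d ≡.refl with factorₚ d b h (rec smaller) d≢0
    where
    d≢0 : d ≢ +0
    d≢0 ≡.refl = a≢0 ≡.refl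
    smaller : ℤ.∣ d ∣ ℕ.< ℤ.∣ d ℤ.* + p ∣
    smaller = ≡.subst (ℤ.∣ d ∣ ℕ.<_) (≡.sym (ℤP.abs-* d (+ p)))
      (ℕP.m<m*n ℤ.∣ d ∣ p {{ℕ.≢-nonZero (d≢0 ∘ ℤP.∣i∣≡0⇒i≡0)}} (ℕ.nonTrivial⇒n>1 p {{prime⇒nonTrivial pr}}))
  ...     | t , d∥πᵗ = ℕ.suc t ,
            ∥-step (ℤ[ p ] pr) πₚ (mkℚᵘ (d ℤ.* + p) b , h) (mkℚᵘ d b , h) t
              (*≡* (≡.cong₂ ℤ._*_ (ℤP.*-comm d (+ p)) (≡.cong +_ (ℕP.*-identityˡ (ℕ.suc b))))) d∥πᵗ

  isDiscreteValuationRing : IsDiscreteValuationRing (ℤ[ p ] pr) πₚ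
  isDiscreteValuationRing = record
    { ≟0 = λ { (x , _) → x Q.≃? Q.0ℚᵘ }
    ; integral = λ { (x@(mkℚᵘ a _) , _) (y@(mkℚᵘ d _) , _) xy≈0 →
        Sum.map (QP.↥p≡0⇒p≃0 x) (QP.↥p≡0⇒p≃0 y)
          (ℤP.i*j≡0⇒i≡0∨j≡0 a (QP.p≃0⇒↥p≡0 (x Q.* y) xy≈0)) }
    ; π≉0 = λ π≈0 → ¬prime[0] (≡.subst Prime (ℤP.+-injective (QP.p≃0⇒↥p≡0 (proj₁ πₚ) π≈0)) pr)
    -- An inverse of `p` would have a denominator equal, up to sign, to its numerator times `p`,
    -- which the localisation excludes.
    ; π∤1 = λ { ((mkℚᵘ a b , h) , *≡* eq) → h (ℕD.divides ℤ.∣ a ∣ (inverse⇒multiple a b eq)) }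
    ; factor = λ { (x@(mkℚᵘ a b) , h) x≉0 →
        factorₚ a b h (<-wellFounded ℤ.∣ a ∣) (x≉0 ∘ QP.↥p≡0⇒p≃0 x) }
    }
    where
    inverse⇒multiple : ∀ a b → a ℤ.* + p ℤ.* + 1 ≡ + 1 ℤ.* + (ℕ.suc b ℕ.* 1) →
                       ℕ.suc b ≡ ℤ.∣ a ∣ ℕ.* p
    inverse⇒multiple a b eq = begin
      ℕ.suc b                          ≡⟨ ℕP.*-identityʳ (ℕ.suc b) ⟨
      ℕ.suc b ℕ.* 1                    ≡⟨ ≡.cong ℤ.∣_∣ (ℤP.*-identityˡ (+ (ℕ.suc b ℕ.* 1))) ⟨
      ℤ.∣ + 1 ℤ.* + (ℕ.suc b ℕ.* 1) ∣  ≡⟨ ≡.cong ℤ.∣_∣ eq ⟨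
      ℤ.∣ a ℤ.* + p ℤ.* + 1 ∣          ≡⟨ ≡.cong ℤ.∣_∣ (ℤP.*-identityʳ (a ℤ.* + p)) ⟩
      ℤ.∣ a ℤ.* + p ∣                  ≡⟨ ℤP.abs-* a (+ p) ⟩
      ℤ.∣ a ∣ ℕ.* p                    ∎
      where open ≡.≡-Reasoning

-- Modules over the localised integers

module Localised {m ℓm} {p : ℕ} {pr : Prime p} (G : Module (ℤ[ p ] pr) m ℓm) where
  open Module G
  open Theory {p = p} {pr = pr} G
  open CommutativeRing (ℤ[ p ] pr) using (Carrier; semiring)
  open SemiringExp semiring using (_^_)
  open LocalisedIntegers p pr
  open LinearCombinations G

  InP-resp : ∀ {W : Set m} {_<_ : Rel W m} {w} (a : Acc _<_ w) {x y} → x ≈ᴹ y → InP a x → InP a y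
  InP-resp (acc rs) x≈y hx v<w with hx v<w
  ... | z , hz , x≈pz = z , hz , ≈ᴹ-trans (≈ᴹ-sym x≈y) x≈pz

  InP-scale : ∀ {W : Set m} {_<_ : Rel W m} {w} (a : Acc _<_ w) r {x} → InP a x → InP a (r *ₗ x)
  InP-scale (acc rs) r hx v<w with hx v<w
  ... | z , hz , x≈pz = r *ₗ z , InP-scale (rs v<w) r hz ,
        ≈ᴹ-trans (*ₗ-congˡ x≈pz) (*ₗ-comm-assoc r πₚ z)

  -- Packs a well-founded relation and an accessible point into one index, so that `InP` becomes a
  -- family of the shape that `Heights` expects.
  Rank : Set (lsuc m)
  Rank = Σ (Set m) λ W → Σ (Rel W m) λ _<_ → Σ W (Acc _<_)

  OfRank : Rank → Carrierᴹ → Set (m ⊔ ℓm)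
  OfRank (_ , _ , _ , a) = InP a

  OfRank-resp : ∀ ρ {x y} → x ≈ᴹ y → OfRank ρ x → OfRank ρ y
  OfRank-resp (_ , _ , _ , a) = InP-resp a

  OfRank-scale : ∀ ρ r {x} → OfRank ρ x → OfRank ρ (r *ₗ x)
  OfRank-scale (_ , _ , _ , a) = InP-scale a

  open Heights OfRank OfRank-resp OfRank-scale public
  open UlmSequences isDiscreteValuationRing public
  open Comparison G OfRank OfRank-resp OfRank-scale isDiscreteValuationRing public

  LinComb≈lc : ∀ {k} (a : Fin k → Carrier) x → LinComb a x ≈ᴹ lc a x
  LinComb≈lc {ℕ.zero} a x = ≈ᴹ-refl
  LinComb≈lc {ℕ.suc k} a x = +ᴹ-congˡ (LinComb≈lc (a ∘ suc) (x ∘ suc))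

  pow≈ : ∀ k x → pow k x ≈ᴹ πₚ ^ k *ₗ x
  pow≈ ℕ.zero x = ≈ᴹ-sym (*ₗ-identityˡ x)
  pow≈ (ℕ.suc k) x = ≈ᴹ-trans (*ₗ-congˡ (pow≈ k x)) (≈ᴹ-sym (*ₗ-assoc πₚ (πₚ ^ k) x))

  UlmEquiv⇒∼ : ∀ {x y} → UlmEquiv x y → x ∼ y
  UlmEquiv⇒∼ {x} {y} (k , l , 0<k , 0<l , same) = k , l , 0<k , 0<l , λ t → begin
    πₚ ^ (t ℕ.+ l) *ₗ x   ≈⟨ ≍-reflexive (pow≈ (t ℕ.+ l) x) ⟨
    pow (t ℕ.+ l) x       ≈⟨ (λ { (W , _<_ , w , a) → same t W _<_ w a }) ⟩
    pow (t ℕ.+ k) y       ≈⟨ ≍-reflexive (pow≈ (t ℕ.+ k) y) ⟩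
    πₚ ^ (t ℕ.+ k) *ₗ y   ∎
    where open ≍-Reasoning

  ∼⇒UlmEquiv : ∀ {x y} → x ∼ y → UlmEquiv x y
  ∼⇒UlmEquiv {x} {y} (k , l , 0<k , 0<l , same) = k , l , 0<k , 0<l , λ t W _<_ w a → (begin
    pow (t ℕ.+ l) x       ≈⟨ ≍-reflexive (pow≈ (t ℕ.+ l) x) ⟩
    πₚ ^ (t ℕ.+ l) *ₗ x   ≈⟨ same t ⟩
    πₚ ^ (t ℕ.+ k) *ₗ y   ≈⟨ ≍-reflexive (pow≈ (t ℕ.+ k) y) ⟨
    pow (t ℕ.+ k) y       ∎) (W , _<_ , w , a)
    where open ≍-Reasoning

  ∼-respˡ : ∀ {x x′ y} → x ≈ᴹ x′ → x ∼ y → x′ ∼ y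
  ∼-respˡ {x} {x′} {y} x≈x′ (k , l , 0<k , 0<l , same) = k , l , 0<k , 0<l , λ t → begin
    πₚ ^ (t ℕ.+ l) *ₗ x′  ≈⟨ ≍-reflexive (*ₗ-congˡ (≈ᴹ-sym x≈x′)) ⟩
    πₚ ^ (t ℕ.+ l) *ₗ x   ≈⟨ same t ⟩
    πₚ ^ (t ℕ.+ k) *ₗ y   ∎
    where open ≍-Reasoning

  linearlyIndependent : ∀ {X} → IsDecompositionSet X → LinearlyIndependent (elt X)
  linearlyIndependent {X} (indep , _) a a≈0 = indep a (≈ᴹ-trans (LinComb≈lc a (elt X)) a≈0)

  heightIndependent : ∀ {X} → IsDecompositionSet X → HeightIndependent (elt X)
  heightIndependent {X} (_ , _ , minimum) e ρ@(W , _<_ , w , a) =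
    proj₁ (minimum e W _<_ w a) ∘ InP-resp a (≈ᴹ-sym (LinComb≈lc e (elt X))) ,
    InP-resp a (LinComb≈lc e (elt X)) ∘ proj₂ (minimum e W _<_ w a)

  ⊆ₛ-trans : ∀ X Y Z → X ⊆ₛ Y → Y ⊆ₛ Z → X ⊆ₛ Z
  ⊆ₛ-trans X Y Z X⊆Y Y⊆Z i with X⊆Y i
  ... | j , xᵢ≈yⱼ with Y⊆Z j
  ...   | k , yⱼ≈zₖ = k , ≈ᴹ-trans xᵢ≈yⱼ yⱼ≈zₖ

  -- The elements are adjoined one at a time. Each enlargement stays inside `C`, and `spans⁰-extend`
  -- merges the denominators, starting from 1.
  extend : ∀ {c} {C : Pred FinSet c} → IsPartialDecompositionBasis C →
    ∀ {k} (x : Fin k → Carrierᴹ) X → C X →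
    Σ FinSet λ Y → C Y × X ⊆ₛ Y × Spans⁰ (elt Y) x
  extend basis {ℕ.zero} x X X∈C =
    X , X∈C , (λ i → i , ≈ᴹ-refl) , Localisation.1ₚ p pr ,
    DiscreteValuation.1≉0 isDiscreteValuationRing , λ ()
  extend basis@(_ , _ , enlarge) {ℕ.suc k} x X X∈C with extend basis (x ∘ suc) X X∈C
  ... | Y , Y∈C , X⊆Y , span with enlarge Y Y∈C (x zero)
  ...   | Z , Z∈C , Y⊆Z , a , a≉0 , e , ax≈ =
          Z , Z∈C , ⊆ₛ-trans X Y Z X⊆Y Y⊆Z ,
          spans⁰-extend Y⊆Z span (a , a≉0 , e , ≈ᴹ-trans ax≈ (LinComb≈lc e (elt Z)))

-- Comparison of two partial decomposition bases

theorem7 : (lem : ∀ {ℓ} → ExcludedMiddle ℓ) →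
    {m ℓm c : Level} (p : ℕ) (pr : Prime p) (G : Module (ℤ[ p ] pr) m ℓm)
    (C C' : Pred (Theory.FinSet G) c) →
    Theory.IsPartialDecompositionBasis G C →
    Theory.IsPartialDecompositionBasis G C' →
    (g : Module.Carrierᴹ G) (n : ℕ) →
    Theory.ŵ≥ G C g n →
    (Y : Theory.FinSet G) → C' Y →
    Σ (Theory.FinSet G) λ Ỹ →
    C' Ỹ × Theory._⊆ₛ_ G Y Ỹ × Theory.ContainsAtLeast G Ỹ n g
theorem7 lem {m} {ℓm} p pr G C C' basis basis' g n (X , X∈C , f , f-injective , f∼g) Y Y∈C'
  with Localised.extend {p = p} {pr = pr} G basis' (Theory.elt X ∘ f) Y Y∈C'
... | Y₁ , Y₁∈C' , Y⊆Y₁ , a , a≉0 , X-span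
  with Localised.extend {p = p} {pr = pr} G basis (Theory.elt Y₁) X X∈C
... | X₁ , X₁∈C , X⊆X₁ , b , b≉0 , Y-span
  -- Excluded middle makes membership in the class of `g` decidable.
  with injection-or-cover (λ j → lem {P = Theory.UlmEquiv G (Theory.elt Y₁ j) g}) n
-- Distinct indices give distinct elements because `Y₁` is linearly independent.
... | inj₁ (f′ , f′-injective , f′∼g) = Y₁ , Y₁∈C' , Y⊆Y₁ , f′ ,
      (λ i j e → f′-injective i j (independent-injective
        (DiscreteValuation.1≉0 (LocalisedIntegers.isDiscreteValuationRing p pr))
        (linearlyIndependent (proj₁ (proj₂ basis') Y₁ Y₁∈C')) (f′ i) (f′ j) e)) ,
      f′∼g
  where
  open LinearCombinations G
  open Localised {p = p} {pr = pr} G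
... | inj₂ (k , χ , k<n , cover) = ⊥-elim contradiction
  where
  open Module G
  open Theory {p = p} {pr = pr} G
  open LinearCombinations G
  open Localised {p = p} {pr = pr} G
  σ : Fin n → Fin (size X₁)
  σ i = proj₁ (X⊆X₁ (f i))
  x≈ : ∀ i → elt X (f i) ≈ᴹ elt X₁ (σ i)
  x≈ i = proj₂ (X⊆X₁ (f i))
  σ-injective : ∀ i j → σ i ≡ σ j → i ≡ j
  -- The chosen elements of `X` are distinct in the module, so their copies in `X₁` occupy distinct
  -- positions.
  σ-injective i j σᵢ≡σⱼ = f-injective i j (≈ᴹ-trans (x≈ i)
    (≈ᴹ-trans (≈ᴹ-reflexive (≡.cong (elt X₁) σᵢ≡σⱼ)) (≈ᴹ-sym (x≈ j))))
  open Exchange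
    (linearlyIndependent (proj₁ (proj₂ basis) X₁ X₁∈C))
    (heightIndependent (proj₁ (proj₂ basis) X₁ X₁∈C))
    (heightIndependent (proj₁ (proj₂ basis') Y₁ Y₁∈C'))
    σ-injective
    (λ i → ∼-respˡ (x≈ i) (UlmEquiv⇒∼ (f∼g i)))
    a≉0
    (λ i → ≈ᴹ-trans (*ₗ-congˡ (≈ᴹ-sym (x≈ i))) (proj₂ (X-span i)))
    b≉0
    (λ j → proj₂ (Y-span j))
    k<n
    (λ j y∼g → cover j (∼⇒UlmEquiv y∼g))
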